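{- Let $G$ be a simple $(m,r)$-graph such that $\binom{m-1}{2}\le r\le\binom{m}{2}$, and let $k:=\binom{m}{2}$. Then $$\Sigma(G)\le m(m-1)(m-2)+(k-r)(k-r-1)-4(k-r)(m-2)+2r.$$
   Context: An $(m,r)$-graph is a graph with vertex set $\{1,\dots,m\}$ and exactly $r$ edges. For a simple $(m,r)$-graph $G$, $g_i(G)$ is the degree of vertex $i$, and $\Sigma(G):=\sum_{i=1}^m g_i(G)^2$. -}

module Defs where

open import Data.Nat using (ℕ; _^_)
open import Data.Fin using (Fin; _<?_)
open import Data.List using (List; length; filter; map; allFin; cartesianProduct)
open import Data.Nat.ListAction using (sum)
open import Data.Product using (_×_; _,_)
open import Level using (0ℓ)
open import Relation.Binary using (Rel; Symmetric; Decidable)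
open import Relation.Nullary using (¬_)
open import Relation.Nullary.Decidable using (_×-dec_)

-- Vertices 1, …, m are represented by Fin m. Adjacency is decidable, as always
-- (classically) for a finite graph, so that degrees and edges can be counted.
record SimpleGraph (m : ℕ) : Set₁ where
  infix 4 _~_ _~?_
  field
    _~_      : Rel (Fin m) 0ℓ
    _~?_     : Decidable _~_
    ~-sym    : Symmetric _~_
    ~-irrefl : ∀ i → ¬ (i ~ i)

  degree : Fin m → ℕ
  degree i = length (filter (i ~?_) (allFin m))

  -- An edge {i , j} is listed once, as the pair (i , j) with i < j.
  edges : List (Fin m × Fin m)
  edges = filter (λ (i , j) → (i <? j) ×-dec (i ~? j))
                 (cartesianProduct (allFin m) (allFin m))

  numEdges : ℕ
  numEdges = length edges

  sumSqDegrees : ℕ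
  sumSqDegrees = sum (map (λ i → degree i ^ 2) (allFin m))

open SimpleGraph public using (degree; edges; numEdges; sumSqDegrees)

{-# OPTIONS --safe #-}
-- Pass to the complement H of G, with s = k - r edges: deg_G = m - 1 - deg_H and
-- Σ deg_H = 2s turn the claim into Σ(H) ≤ s (s + 1). Since
-- Σ(H) = Σ_{uv ∈ E(H)} (deg u + deg v), this holds because deg u + deg v ≤ s + 1
-- for every edge uv: the edge uv itself is the only one counted by both degrees.
module Submission where

open import Data.Nat using (ℕ; _∸_) renaming (_≤_ to _≤ℕ_)
open import Data.Nat.Combinatorics using (_C_)
open import Relation.Binary.PropositionalEquality using (_≡_)
open import Defs

open import Data.Bool using (if_then_else_; true; false)
open import Data.Fin using (Fin; zero; suc; _≟_; _<?_)
import Data.Fin.Properties as Fin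
import Data.Integer as ℤ
import Data.Integer.Properties as ℤ
import Data.Integer.Tactic.RingSolver as ℤ-Solver
open import Data.List using (length; filter; map; tabulate; cartesianProduct; _++_)
open import Data.List.Properties using (filter-++; length-++; map-tabulate)
import Data.Nat as Nat
import Data.Nat.Combinatorics as ℕ
import Data.Nat.ListAction as List
import Data.Nat.Properties as ℕ
open import Data.Nat.Tactic.RingSolver using (solve-∀)
open import Data.Product using (_×_; _,_)
open import Function using (_∘_; id; _⇔_; mk⇔)
open import Level using (Level)
open import Relation.Binary using (tri<; tri≈; tri>)
open import Relation.Binary.PropositionalEquality
  using (_≢_; refl; sym; trans; cong; cong₂; subst₂; module ≡-Reasoning)
open import Relation.Nullary using (Dec; yes; no; does; ¬_; contradiction)
open import Relation.Nullary.Decidable using (_×-dec_; ¬?; dec-true; dec-false; does-⇔)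
open import Relation.Unary using (Pred; Decidable)

private
  variable
    a b p : Level
    A : Set a
    B : Set b
    m n : ℕ

module _ where
  open Nat using (_+_; _*_; _≤_; _^_)
  open import Algebra.Properties.Semiring.Sum ℕ.+-*-semiring

  -- Indicators and finite sums of natural numbers.

  𝟙 : Dec A → ℕ
  𝟙 a? = if does a? then 1 else 0

  𝟙-true : (a? : Dec A) → A → 𝟙 a? ≡ 1
  𝟙-true a? x = cong (if_then 1 else 0) (dec-true a? x)

  𝟙-false : (a? : Dec A) → ¬ A → 𝟙 a? ≡ 0
  𝟙-false a? ¬x = cong (if_then 1 else 0) (dec-false a? ¬x)

  𝟙-cong : A ⇔ B → (a? : Dec A) (b? : Dec B) → 𝟙 a? ≡ 𝟙 b?
  𝟙-cong A⇔B a? b? = cong (if_then 1 else 0) (does-⇔ A⇔B a? b?)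

  ∑-mono-≤ : {f g : Fin n → ℕ} → (∀ i → f i ≤ g i) → ∑[ i < n ] f i ≤ ∑[ i < n ] g i
  ∑-mono-≤ {Nat.zero}  f≤g = Nat.z≤n
  ∑-mono-≤ {Nat.suc n}  f≤g = ℕ.+-mono-≤ (f≤g zero) (∑-mono-≤ (f≤g ∘ suc))

  ∑-const : ∀ n c → ∑[ i < n ] c ≡ n * c
  ∑-const Nat.zero    c = refl
  ∑-const (Nat.suc n) c = cong (c +_) (∑-const n c)

  -- Spreads a single value over all indices, so that relations singling out particular vertices can
  -- be checked summand by summand.
  ∑-𝟙≟ : (u : Fin n) (f : Fin n → ℕ) → ∑[ i < n ] (𝟙 (i ≟ u) * f i) ≡ f u
  ∑-𝟙≟ {Nat.suc n} zero    f =
    trans (cong₂ _+_ (ℕ.*-identityˡ (f zero)) (sum-replicate-zero n)) (ℕ.+-identityʳ (f zero))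
  -- The head summand `0 * f zero` vanishes by computation, and `does (suc i ≟ suc u)` reduces to
  -- `does (i ≟ u)`.
  ∑-𝟙≟ {Nat.suc n} (suc u) f = ∑-𝟙≟ u (f ∘ suc)

  -- List lengths and list sums as finite sums.

  length-filter-tabulate : {P : Pred A p} (P? : Decidable P) (f : Fin n → A) →
    length (filter P? (tabulate f)) ≡ ∑[ i < n ] 𝟙 (P? (f i))
  length-filter-tabulate {n = Nat.zero}  P? f = refl
  length-filter-tabulate {n = Nat.suc n} P? f with does (P? (f zero))
  ... | true  = cong Nat.suc (length-filter-tabulate P? (f ∘ suc))
  ... | false = length-filter-tabulate P? (f ∘ suc)

  length-filter-cartesianProduct : {P : Pred (A × B) p} (P? : Decidable P)
    (f : Fin m → A) (g : Fin n → B) →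
    length (filter P? (cartesianProduct (tabulate f) (tabulate g))) ≡
    ∑[ i < m ] ∑[ j < n ] 𝟙 (P? (f i , g j))
  length-filter-cartesianProduct {m = Nat.zero}  P? f g = refl
  length-filter-cartesianProduct {m = Nat.suc m} P? f g = begin
    length (filter P? (row ++ rest))
      ≡⟨ cong length (filter-++ P? row rest) ⟩
    length (filter P? row ++ filter P? rest)
      ≡⟨ length-++ (filter P? row) ⟩
    length (filter P? row) + length (filter P? rest)
      ≡⟨ cong₂ _+_ (trans (cong (length ∘ filter P?) (map-tabulate g (f zero ,_)))
                          (length-filter-tabulate P? (λ j → f zero , g j)))
                   (length-filter-cartesianProduct P? (f ∘ suc) g) ⟩
    _ ∎
    where
    open ≡-Reasoning
    row  = map (f zero ,_) (tabulate g)
    rest = cartesianProduct (tabulate (f ∘ suc)) (tabulate g)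

  sum-map-tabulate : (h : A → ℕ) (f : Fin n → A) →
    List.sum (map h (tabulate f)) ≡ ∑[ i < n ] h (f i)
  sum-map-tabulate {n = Nat.zero}  h f = refl
  sum-map-tabulate {n = Nat.suc n} h f = cong (h (f zero) +_) (sum-map-tabulate h (f ∘ suc))

  -- By Pascal's rule `n C 2` grows by `n`, so the left side grows by `2 * n + 1`, the gap between
  -- consecutive squares. This form avoids division and subtraction.
  2*nC2+n≡n² : ∀ n → 2 * (n C 2) + n ≡ n * n
  2*nC2+n≡n² Nat.zero    = refl
  2*nC2+n≡n² (Nat.suc n) = begin
    2 * (Nat.suc n C 2) + Nat.suc n
      ≡⟨ cong (λ x → 2 * x + Nat.suc n) (ℕ.nCk+nC[k+1]≡[n+1]C[k+1] n 1) ⟨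
    2 * (n C 1 + n C 2) + Nat.suc n
      ≡⟨ cong (λ x → 2 * (x + n C 2) + Nat.suc n) (ℕ.nC1≡n n) ⟩
    2 * (n + n C 2) + Nat.suc n
      ≡⟨ regroup n (n C 2) ⟩
    (2 * (n C 2) + n) + (2 * n + 1)
      ≡⟨ cong (_+ (2 * n + 1)) (2*nC2+n≡n² n) ⟩
    n * n + (2 * n + 1)
      ≡⟨ square n ⟩
    Nat.suc n * Nat.suc n ∎
    where
    open ≡-Reasoning
    regroup : ∀ n c → 2 * (n + c) + (1 + n) ≡ (2 * c + n) + (2 * n + 1)
    regroup = solve-∀
    square : ∀ n → n * n + (2 * n + 1) ≡ (1 + n) * (1 + n)
    square = solve-∀

  -- A single graph: adjacency matrix, handshake lemma, bound on the squared degrees.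

  module _ (G : SimpleGraph m) where
    open SimpleGraph G using (_~_; _~?_; ~-sym; ~-irrefl)

    adj : Fin m → Fin m → ℕ
    adj i j = 𝟙 (i ~? j)

    adj-sym : ∀ i j → adj i j ≡ adj j i
    adj-sym i j = 𝟙-cong (mk⇔ ~-sym ~-sym) (i ~? j) (j ~? i)

    degree≡∑adj : ∀ i → degree G i ≡ ∑[ j < m ] adj i j
    degree≡∑adj i = length-filter-tabulate (i ~?_) id

    sumSqDegrees≡∑ : sumSqDegrees G ≡ ∑[ i < m ] (degree G i ^ 2)
    sumSqDegrees≡∑ = sum-map-tabulate (λ i → degree G i ^ 2) id

    -- Handshake lemma. The adjacency matrix is its strict upper triangle `up` plus the transpose of
    -- `up`. Exchanging the order of summation shows that both have the same total, the number of
    -- edges.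
    ∑degree≡2*numEdges : ∑[ i < m ] degree G i ≡ 2 * numEdges G
    ∑degree≡2*numEdges = begin
      ∑[ i < m ] degree G i
        ≡⟨ sum-cong-≗ degree≡∑adj ⟩
      ∑[ i < m ] ∑[ j < m ] adj i j
        ≡⟨ sum-cong-≗ (λ i → trans (sum-cong-≗ (split i)) (∑-distrib-+ (up i) (λ j → up j i))) ⟩
      ∑[ i < m ] (∑[ j < m ] up i j + ∑[ j < m ] up j i)
        ≡⟨ ∑-distrib-+ (λ i → ∑[ j < m ] up i j) (λ i → ∑[ j < m ] up j i) ⟩
      ∑[ i < m ] ∑[ j < m ] up i j + ∑[ i < m ] ∑[ j < m ] up j i
        ≡⟨ cong (∑[ i < m ] ∑[ j < m ] up i j +_) (∑-comm up) ⟨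
      ∑[ i < m ] ∑[ j < m ] up i j + ∑[ i < m ] ∑[ j < m ] up i j
        ≡⟨ cong₂ _+_ numEdges≡∑up (trans (ℕ.+-identityʳ (numEdges G)) numEdges≡∑up) ⟨
      2 * numEdges G ∎
      where
      open ≡-Reasoning
      up? : ∀ i j → Dec _
      up? i j = (i <? j) ×-dec (i ~? j)

      up : Fin m → Fin m → ℕ
      up i j = 𝟙 (up? i j)

      numEdges≡∑up : numEdges G ≡ ∑[ i < m ] ∑[ j < m ] up i j
      numEdges≡∑up = length-filter-cartesianProduct (λ (i , j) → up? i j) id id

      split : ∀ i j → adj i j ≡ up i j + up j i
      split i j with Fin.<-cmp i j
      ... | tri< i<j _ j≮i = sym (trans
        (cong₂ _+_ (𝟙-cong (mk⇔ (λ (_ , e) → e) (i<j ,_)) (up? i j) (i ~? j))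
                   (𝟙-false (up? j i) (λ (j<i , _) → j≮i j<i)))
        (ℕ.+-identityʳ (adj i j)))
      ... | tri≈ i≮i refl _ = trans (𝟙-false (i ~? i) (~-irrefl i))
        (sym (cong₂ _+_ up≡0 up≡0))
        where
        up≡0 : up i i ≡ 0
        up≡0 = 𝟙-false (up? i i) (λ (i<i , _) → i≮i i<i)
      ... | tri> i≮j _ j<i = sym (cong₂ _+_
        (𝟙-false (up? i j) (λ (i<j , _) → i≮j i<j))
        (𝟙-cong (mk⇔ (λ (_ , e) → ~-sym e) (λ e → j<i , ~-sym e)) (up? j i) (i ~? j)))

    -- The two terms are entries of row `i` in different columns, so both occur in the row sum
    -- without overlap.
    adj+adj≤degree : ∀ i {u v} → u ≢ v → adj i u + adj i v ≤ degree G i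
    adj+adj≤degree i {u} {v} u≢v = begin
      adj i u + adj i v
        ≡⟨ cong₂ _+_ (∑-𝟙≟ u (adj i)) (∑-𝟙≟ v (adj i)) ⟨
      ∑[ j < m ] (𝟙 (j ≟ u) * adj i j) + ∑[ j < m ] (𝟙 (j ≟ v) * adj i j)
        ≡⟨ ∑-distrib-+ (λ j → 𝟙 (j ≟ u) * adj i j) (λ j → 𝟙 (j ≟ v) * adj i j) ⟨
      ∑[ j < m ] (𝟙 (j ≟ u) * adj i j + 𝟙 (j ≟ v) * adj i j)
        ≤⟨ ∑-mono-≤ pointwise ⟩
      ∑[ j < m ] adj i j
        ≡⟨ degree≡∑adj i ⟨
      degree G i ∎
      where
      open ℕ.≤-Reasoning
      pointwise : ∀ j → 𝟙 (j ≟ u) * adj i j + 𝟙 (j ≟ v) * adj i j ≤ adj i j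
      pointwise j with j ≟ u | j ≟ v
      ... | yes refl | yes refl = contradiction refl u≢v
      ... | yes _    | no _     = ℕ.≤-reflexive (trans (ℕ.+-identityʳ _) (ℕ.*-identityˡ _))
      ... | no _     | yes _    = ℕ.≤-reflexive (ℕ.*-identityˡ _)
      ... | no _     | no _     = Nat.z≤n

    -- Both sides are doubled so that 2 s can be written as Σ deg; then vertices i ≠ u , v
    -- contribute deg i ≥ adj i u + adj i v, and u and v themselves account for the 2.
    degree+degree≤1+numEdges : ∀ {u v} → u ~ v → degree G u + degree G v ≤ 1 + numEdges G
    degree+degree≤1+numEdges {u} {v} u~v = ℕ.*-cancelˡ-≤ 2 (begin
      2 * (d u + d v)
        ≡⟨ double (d u) (d v) ⟩
      (d u + d v) + (d u + d v)
        -- One copy of `d u + d v` is spread over the vertices as two matrix columns. The other is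
        -- placed as point masses at `u` and `v`, where it will cancel the `d i` on the right.
        ≡⟨ cong₂ _+_ (cong₂ _+_ (column u) (column v))
                     (cong₂ _+_ (sym (∑-𝟙≟ u d)) (sym (∑-𝟙≟ v d))) ⟩
      (∑[ i < m ] adj i u + ∑[ i < m ] adj i v) +
      (∑[ i < m ] (𝟙 (i ≟ u) * d i) + ∑[ i < m ] (𝟙 (i ≟ v) * d i))
        ≡⟨ cong₂ _+_ (∑-distrib-+ (λ i → adj i u) (λ i → adj i v))
                     (∑-distrib-+ (λ i → 𝟙 (i ≟ u) * d i) (λ i → 𝟙 (i ≟ v) * d i)) ⟨
      ∑[ i < m ] (adj i u + adj i v) +
      ∑[ i < m ] (𝟙 (i ≟ u) * d i + 𝟙 (i ≟ v) * d i)
        ≡⟨ ∑-distrib-+ (λ i → adj i u + adj i v) (λ i → 𝟙 (i ≟ u) * d i + 𝟙 (i ≟ v) * d i) ⟨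
      ∑[ i < m ] ((adj i u + adj i v) + (𝟙 (i ≟ u) * d i + 𝟙 (i ≟ v) * d i))
        ≤⟨ ∑-mono-≤ pointwise ⟩
      ∑[ i < m ] ((𝟙 (i ≟ u) * 1 + 𝟙 (i ≟ v) * 1) + d i)
        ≡⟨ ∑-distrib-+ (λ i → 𝟙 (i ≟ u) * 1 + 𝟙 (i ≟ v) * 1) d ⟩
      ∑[ i < m ] (𝟙 (i ≟ u) * 1 + 𝟙 (i ≟ v) * 1) + ∑[ i < m ] d i
        ≡⟨ cong₂ _+_
             (trans (∑-distrib-+ (λ i → 𝟙 (i ≟ u) * 1) (λ i → 𝟙 (i ≟ v) * 1))
                    (cong₂ _+_ (∑-𝟙≟ u (λ _ → 1)) (∑-𝟙≟ v (λ _ → 1))))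
             ∑degree≡2*numEdges ⟩
      2 + 2 * numEdges G
        ≡⟨ ℕ.*-distribˡ-+ 2 1 (numEdges G) ⟨
      2 * (1 + numEdges G) ∎)
      where
      open ℕ.≤-Reasoning
      d : Fin m → ℕ
      d = degree G

      double : ∀ x y → 2 * (x + y) ≡ (x + y) + (x + y)
      double = solve-∀

      column : ∀ w → d w ≡ ∑[ i < m ] adj i w
      column w = trans (degree≡∑adj w) (sum-cong-≗ (adj-sym w))

      u≢v : u ≢ v
      u≢v refl = ~-irrefl u u~v

      pointwise : ∀ i → (adj i u + adj i v) + (𝟙 (i ≟ u) * d i + 𝟙 (i ≟ v) * d i)
                        ≤ (𝟙 (i ≟ u) * 1 + 𝟙 (i ≟ v) * 1) + d i
      pointwise i with i ≟ u | i ≟ v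
      ... | yes refl | yes refl = contradiction refl u≢v
      -- Equality holds at an endpoint: the degrees cancel, the diagonal entry is 0, and the 1 on
      -- the right is matched by the edge `u ~ v`.
      ... | yes refl | no _
        rewrite 𝟙-false (u ~? u) (~-irrefl u) | 𝟙-true (u ~? v) u~v
              | ℕ.+-identityʳ (d u) | ℕ.+-identityʳ (d u) = ℕ.≤-refl
      ... | no _     | yes refl
        rewrite 𝟙-false (v ~? v) (~-irrefl v) | 𝟙-true (v ~? u) (~-sym u~v)
              | ℕ.+-identityʳ (d v) = ℕ.≤-refl
      ... | no _     | no _     =
        ℕ.≤-trans (ℕ.≤-reflexive (ℕ.+-identityʳ _)) (adj+adj≤degree i u≢v)

    -- The sum runs over ordered pairs, in which every edge occurs twice; hence the factor 2.
    sumSqDegrees≤ : sumSqDegrees G ≤ numEdges G * (1 + numEdges G)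
    sumSqDegrees≤ = ℕ.*-cancelˡ-≤ 2 (begin
      2 * sumSqDegrees G
        ≡⟨ cong (sumSqDegrees G +_) (ℕ.+-identityʳ (sumSqDegrees G)) ⟩
      sumSqDegrees G + sumSqDegrees G
        -- The second copy is transposed, so that each adjacent pair carries `d i + d j` instead of
        -- `d i` twice.
        ≡⟨ cong₂ _+_ rows (trans rows (trans (∑-comm (λ i j → adj i j * d i))
             (sum-cong-≗ (λ i → sum-cong-≗ (λ j → cong (_* d j) (adj-sym j i)))))) ⟩
      ∑[ i < m ] ∑[ j < m ] (adj i j * d i) + ∑[ i < m ] ∑[ j < m ] (adj i j * d j)
        ≡⟨ ∑-distrib-+ (λ i → ∑[ j < m ] (adj i j * d i)) (λ i → ∑[ j < m ] (adj i j * d j)) ⟨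
      ∑[ i < m ] (∑[ j < m ] (adj i j * d i) + ∑[ j < m ] (adj i j * d j))
        ≡⟨ sum-cong-≗ (λ i → ∑-distrib-+ (λ j → adj i j * d i) (λ j → adj i j * d j)) ⟨
      ∑[ i < m ] ∑[ j < m ] (adj i j * d i + adj i j * d j)
        ≤⟨ ∑-mono-≤ (λ i → ∑-mono-≤ (pointwise i)) ⟩
      ∑[ i < m ] ∑[ j < m ] (adj i j * (1 + s))
        ≡⟨ sum-cong-≗ (λ i → trans (cong (_* (1 + s)) (degree≡∑adj i)) (*-distribʳ-sum (1 + s) (adj i))) ⟨
      ∑[ i < m ] (d i * (1 + s))
        ≡⟨ *-distribʳ-sum (1 + s) d ⟨
      ∑[ i < m ] d i * (1 + s)
        ≡⟨ cong (_* (1 + s)) ∑degree≡2*numEdges ⟩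
      2 * s * (1 + s)
        ≡⟨ ℕ.*-assoc 2 s (1 + s) ⟩
      2 * (s * (1 + s)) ∎)
      where
      open ℕ.≤-Reasoning
      d : Fin m → ℕ
      d = degree G

      s : ℕ
      s = numEdges G

      rows : sumSqDegrees G ≡ ∑[ i < m ] ∑[ j < m ] (adj i j * d i)
      rows = trans sumSqDegrees≡∑ (sum-cong-≗ (λ i →
        trans (cong (d i *_) (ℕ.*-identityʳ (d i)))
        (trans (cong (_* d i) (degree≡∑adj i)) (*-distribʳ-sum (d i) (adj i)))))

      pointwise : ∀ i j → adj i j * d i + adj i j * d j ≤ adj i j * (1 + s)
      pointwise i j with i ~? j
      ... | yes i~j = subst₂ _≤_ (sym (cong₂ _+_ (ℕ.*-identityˡ (d i)) (ℕ.*-identityˡ (d j))))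
                                 (sym (ℕ.*-identityˡ (1 + s))) (degree+degree≤1+numEdges i~j)
      ... | no _    = Nat.z≤n

    -- The complement: its degrees, edges and squared degrees.

    complement : SimpleGraph m
    complement = record
      { _~_      = λ i j → i ≢ j × ¬ i ~ j
      ; _~?_     = λ i j → ¬? (i ≟ j) ×-dec ¬? (i ~? j)
      ; ~-sym    = λ (i≢j , i≁j) → (i≢j ∘ sym) , (i≁j ∘ ~-sym)
      ; ~-irrefl = λ i (i≢i , _) → i≢i refl
      }

  -- Every vertex is exactly one of: a neighbour of `i` in `G`, a neighbour of `i` in the
  -- complement, or `i` itself, which is the 1.
  degree+degree-complement : ∀ (G : SimpleGraph m) i →
    degree G i + (degree (complement G) i + 1) ≡ m
  degree+degree-complement {m} G i = begin
    degree G i + (degree H i + 1)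
      ≡⟨ cong₂ _+_ (degree≡∑adj G i) (cong₂ _+_ (degree≡∑adj H i) (sym (∑-𝟙≟ i (λ _ → 1)))) ⟩
    ∑[ j < m ] adj G i j + (∑[ j < m ] adj H i j + ∑[ j < m ] (𝟙 (j ≟ i) * 1))
      ≡⟨ cong (∑[ j < m ] adj G i j +_) (∑-distrib-+ (adj H i) (λ j → 𝟙 (j ≟ i) * 1)) ⟨
    ∑[ j < m ] adj G i j + ∑[ j < m ] (adj H i j + 𝟙 (j ≟ i) * 1)
      ≡⟨ ∑-distrib-+ (adj G i) (λ j → adj H i j + 𝟙 (j ≟ i) * 1) ⟨
    ∑[ j < m ] (adj G i j + (adj H i j + 𝟙 (j ≟ i) * 1))
      ≡⟨ sum-cong-≗ pointwise ⟩
    ∑[ j < m ] 1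
      ≡⟨ ∑-const m 1 ⟩
    m * 1
      ≡⟨ ℕ.*-identityʳ m ⟩
    m ∎
    where
    open ≡-Reasoning
    open SimpleGraph G using (_~?_; ~-irrefl)
    H = complement G

    pointwise : ∀ j → adj G i j + (adj H i j + 𝟙 (j ≟ i) * 1) ≡ 1
    -- Both orders of the equality test are split, since the complement tests `i ≟ j` and the point
    -- mass tests `j ≟ i`.
    pointwise j with i ≟ j | j ≟ i | i ~? j
    ... | yes refl | _        | yes i~i = contradiction i~i (~-irrefl i)
    ... | yes refl | yes _    | no _    = refl
    ... | yes refl | no i≢i   | no _    = contradiction refl i≢i
    ... | no i≢i   | yes refl | _       = contradiction refl i≢i
    ... | no _     | no _     | yes _   = refl
    ... | no _     | no _     | no _    = refl

  -- The degree relation summed over all vertices. The doubled form serves both the binomial formula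
  -- and the final integer computation.
  numEdges+numEdges-complement : (G : SimpleGraph m) →
    2 * numEdges G + (2 * numEdges (complement G) + m) ≡ m * m
  numEdges+numEdges-complement {m} G = begin
    2 * numEdges G + (2 * numEdges H + m)
      ≡⟨ cong₂ _+_ (∑degree≡2*numEdges G) (cong₂ _+_ (∑degree≡2*numEdges H)
           (trans (∑-const m 1) (ℕ.*-identityʳ m))) ⟨
    ∑[ i < m ] degree G i + (∑[ i < m ] degree H i + ∑[ i < m ] 1)
      ≡⟨ cong (∑[ i < m ] degree G i +_) (∑-distrib-+ (degree H) (λ _ → 1)) ⟨
    ∑[ i < m ] degree G i + ∑[ i < m ] (degree H i + 1)
      ≡⟨ ∑-distrib-+ (degree G) (λ i → degree H i + 1) ⟨
    ∑[ i < m ] (degree G i + (degree H i + 1))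
      ≡⟨ sum-cong-≗ (degree+degree-complement G) ⟩
    ∑[ i < m ] m
      ≡⟨ ∑-const m m ⟩
    m * m ∎
    where
    open ≡-Reasoning
    H = complement G

  -- Sum over the vertices of (deg_G)² = (m - (deg_H + 1))², with both sides moved so that no
  -- subtraction occurs.
  sumSqDegrees-complement : (G : SimpleGraph m) → let H = complement G in
    sumSqDegrees G + (2 * m * (2 * numEdges H) + m * (2 * m)) ≡
    sumSqDegrees H + (2 * (2 * numEdges H) + m * (m * m + 1))
  sumSqDegrees-complement {m} G = begin
    sumSqDegrees G + (2 * m * (2 * numEdges H) + m * (2 * m))
      ≡⟨ collect G (2 * m) (2 * m) ⟨
    ∑[ i < m ] (degree G i ^ 2 + (2 * m * degree H i + 2 * m))
      ≡⟨ sum-cong-≗ pointwise ⟩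
    ∑[ i < m ] (degree H i ^ 2 + (2 * degree H i + (m * m + 1)))
      ≡⟨ collect H 2 (m * m + 1) ⟩
    sumSqDegrees H + (2 * (2 * numEdges H) + m * (m * m + 1)) ∎
    where
    open ≡-Reasoning
    H = complement G

    -- `K` will be `G` on one side and `H` on the other, while the linear term always uses the
    -- degrees in `H`.
    collect : ∀ K x y → ∑[ i < m ] (degree K i ^ 2 + (x * degree H i + y)) ≡
                        sumSqDegrees K + (x * (2 * numEdges H) + m * y)
    collect K x y = begin
      ∑[ i < m ] (degree K i ^ 2 + (x * degree H i + y))
        ≡⟨ ∑-distrib-+ (λ i → degree K i ^ 2) (λ i → x * degree H i + y) ⟩
      ∑[ i < m ] (degree K i ^ 2) + ∑[ i < m ] (x * degree H i + y)
        ≡⟨ cong₂ _+_ (sym (sumSqDegrees≡∑ K)) (∑-distrib-+ (λ i → x * degree H i) (λ _ → y)) ⟩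
      sumSqDegrees K + (∑[ i < m ] (x * degree H i) + ∑[ i < m ] y)
        ≡⟨ cong (sumSqDegrees K +_) (cong₂ _+_
             (trans (sym (*-distribˡ-sum x (degree H))) (cong (x *_) (∑degree≡2*numEdges H)))
             (∑-const m y)) ⟩
      sumSqDegrees K + (x * (2 * numEdges H) + m * y) ∎

    -- The expansion of `g` squared with `g` as `n` minus `h + 1`. The factor `g * 1` is there
    -- because `g ^ 2` unfolds to `g * (g * 1)`.
    square : ∀ g h → let n = g + (h + 1) in
      g * (g * 1) + (2 * n * h + 2 * n) ≡ h * (h * 1) + (2 * h + (n * n + 1))
    square = solve-∀

    pointwise : ∀ i → degree G i ^ 2 + (2 * m * degree H i + 2 * m) ≡
                      degree H i ^ 2 + (2 * degree H i + (m * m + 1))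
    pointwise i = begin
      degree G i ^ 2 + (2 * m * degree H i + 2 * m)
        ≡⟨ cong (λ n → degree G i ^ 2 + (2 * n * degree H i + 2 * n)) eq ⟨
      _ ≡⟨ square (degree G i) (degree H i) ⟩
      _ ≡⟨ cong (λ n → degree H i ^ 2 + (2 * degree H i + (n * n + 1))) eq ⟩
      degree H i ^ 2 + (2 * degree H i + (m * m + 1)) ∎
      where eq = degree+degree-complement G i

  -- Identifies the `k - r` of the theorem with the number of edges of the complement.
  numEdges+numEdges-complement≡mC2 : (G : SimpleGraph m) →
    numEdges G + numEdges (complement G) ≡ m C 2
  numEdges+numEdges-complement≡mC2 {m} G = ℕ.*-cancelˡ-≡ _ _ 2 (ℕ.+-cancelʳ-≡ m _ _ (begin
    2 * (e + s) + m        ≡⟨ regroup e s m ⟩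
    2 * e + (2 * s + m)    ≡⟨ numEdges+numEdges-complement G ⟩
    m * m                  ≡⟨ 2*nC2+n≡n² m ⟨
    2 * (m C 2) + m ∎))
    where
    open ≡-Reasoning
    e = numEdges G
    s = numEdges (complement G)
    regroup : ∀ e s m → 2 * (e + s) + m ≡ 2 * e + (2 * s + m)
    regroup = solve-∀

  -- The theorem with `s` for `k - r` and with `2 * r` replaced by `m * m - m - 2 * s`. The negative
  -- terms are moved to the left so that the bound lives in ℕ.
  sumSqDegrees≤-complement : (G : SimpleGraph m) → let s = numEdges (complement G) in
    sumSqDegrees G + (4 * m * s + 2 * m * m) ≤ m * m * m + m + s * s + 5 * s
  sumSqDegrees≤-complement {m} G = begin
    sumSqDegrees G + (4 * m * s + 2 * m * m)
      ≡⟨ cong (sumSqDegrees G +_) (left m s) ⟩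
    sumSqDegrees G + (2 * m * (2 * s) + m * (2 * m))
      ≡⟨ sumSqDegrees-complement G ⟩
    sumSqDegrees (complement G) + (2 * (2 * s) + m * (m * m + 1))
      ≤⟨ ℕ.+-monoˡ-≤ _ (sumSqDegrees≤ (complement G)) ⟩
    s * (1 + s) + (2 * (2 * s) + m * (m * m + 1))
      ≡⟨ right m s ⟩
    m * m * m + m + s * s + 5 * s ∎
    where
    open ℕ.≤-Reasoning
    s = numEdges (complement G)
    left : ∀ m s → 4 * m * s + 2 * m * m ≡ 2 * m * (2 * s) + m * (2 * m)
    left = solve-∀
    right : ∀ m s → s * (1 + s) + (2 * (2 * s) + m * (m * m + 1)) ≡ m * m * m + m + s * s + 5 * s
    right = solve-∀

-- Transfer of the bound to the integers.

open import Data.Integer using (+_; _+_; _-_; _*_; _≤_)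

+-cancelʳ-≤ : ∀ i j k → i + k ≤ j + k → i ≤ j
+-cancelʳ-≤ i j k i+k≤j+k =
  subst₂ _≤_ (i+k-k≡i i k) (i+k-k≡i j k) (ℤ.+-monoˡ-≤ (ℤ.- k) i+k≤j+k)
  where
  i+k-k≡i : ∀ i k → i + k - k ≡ i
  i+k-k≡i = ℤ-Solver.solve-∀

corollary16 : ∀ (m r : ℕ) (G : SimpleGraph m) → numEdges G ≡ r →
    (m ∸ 1) C 2 ≤ℕ r → r ≤ℕ m C 2 →
    let k = m C 2 in
    + sumSqDegrees G ≤
    + m * (+ m - + 1) * (+ m - + 2)
    + (+ k - + r) * (+ k - + r - + 1)
    - + 4 * (+ k - + r) * (+ m - + 2)
    + + 2 * + r
corollary16 m r G refl _ _ = +-cancelʳ-≤ _ (bound (+ (m C 2))) (+ 4 * M * S + + 2 * M * M) (begin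
  + sumSqDegrees G + (+ 4 * M * S + + 2 * M * M)
    ≡⟨ cong (_+_ (+ sumSqDegrees G)) (cong₂ _+_ (pos-** 4 m s) (pos-** 2 m m)) ⟨
  + (sumSqDegrees G Nat.+ (4 Nat.* m Nat.* s Nat.+ 2 Nat.* m Nat.* m))
    ≤⟨ ℤ.+≤+ (sumSqDegrees≤-complement G) ⟩
  + (m Nat.* m Nat.* m Nat.+ m Nat.+ s Nat.* s Nat.+ 5 Nat.* s)
    ≡⟨ cong₂ _+_ (cong₂ _+_ (cong (_+ M) (pos-** m m m)) (ℤ.pos-* s s)) (ℤ.pos-* 5 s) ⟩
  M * M * M + M + S * S + + 5 * S
    -- The two bounds agree only modulo the relation between `E`, `S` and `M`. Its defect is added
    -- as a last summand to get a polynomial identity, and `handshake` then makes that summand 0.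
    ≡⟨ expand M S E ⟩
  bound (E + S) + (+ 4 * M * S + + 2 * M * M) + (M * M - (+ 2 * E + (+ 2 * S + M)))
    ≡⟨ cong (λ z → bound (E + S) + (+ 4 * M * S + + 2 * M * M) + z) (ℤ.i≡j⇒i-j≡0 (sym handshake)) ⟩
  bound (E + S) + (+ 4 * M * S + + 2 * M * M) + + 0
    ≡⟨ ℤ.+-identityʳ _ ⟩
  bound (E + S) + (+ 4 * M * S + + 2 * M * M)
    -- `E + S` computes to `+` of a sum in ℕ, so the edge count of the two graphs can be exchanged
    -- for `m C 2`.
    ≡⟨ cong (λ k → bound (+ k) + (+ 4 * M * S + + 2 * M * M)) (numEdges+numEdges-complement≡mC2 G) ⟩
  bound (+ (m C 2)) + (+ 4 * M * S + + 2 * M * M) ∎)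
  where
  open ℤ.≤-Reasoning
  s = numEdges (complement G)
  M = + m
  S = + s
  E = + r

  -- The binomial coefficient is abstracted as `K`, so that the ring solver can work with `E + S` in
  -- its place.
  bound : ℤ.ℤ → ℤ.ℤ
  bound K = M * (M - + 1) * (M - + 2) + (K - E) * (K - E - + 1)
            - + 4 * (K - E) * (M - + 2) + + 2 * E

  pos-** : ∀ a b c → + (a Nat.* b Nat.* c) ≡ + a * + b * + c
  pos-** a b c = trans (ℤ.pos-* (a Nat.* b) c) (cong (_* + c) (ℤ.pos-* a b))

  handshake : + 2 * E + (+ 2 * S + M) ≡ M * M
  handshake = trans (cong₂ _+_ (sym (ℤ.pos-* 2 r)) (cong (_+ M) (sym (ℤ.pos-* 2 s))))
                    (trans (cong (+_) (numEdges+numEdges-complement G)) (ℤ.pos-* m m))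

  expand : ∀ M S E → M * M * M + M + S * S + + 5 * S ≡
    M * (M - + 1) * (M - + 2) + (E + S - E) * (E + S - E - + 1)
    - + 4 * (E + S - E) * (M - + 2) + + 2 * E
    + (+ 4 * M * S + + 2 * M * M) + (M * M - (+ 2 * E + (+ 2 * S + M)))
  expand = ℤ-Solver.solve-∀
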